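{- Given two lists $\{\alpha_i\}_{i\in[n]}$ and $\{\beta_i\}_{i\in[n]}$ of vectors $\alpha_i,\beta_i\in\{0,1\}^d$, one can construct in time $O(nd)$ two sequences of points $P_1$ and $P_2$ such that $\mathrm{Frechet}(P_1,P_2)=0$ if there are two vectors $\alpha_i$ and $\beta_j$ that are orthogonal, and $\mathrm{Frechet}(P_1,P_2)=1$ otherwise. The points of the sequences come from a pointset with a constant number of points (independent of $n$ and $d$), with a distance function $f$ between points that does not satisfy the triangle inequality.
   Context: $[n]=\{1,\dots,n\}$. Vectors $\alpha,\beta\in\{0,1\}^d$ are orthogonal if $\sum_{h=1}^d\alpha[h]\beta[h]=0$. Discrete Frechet distance: let $x,y$ be two finite sequences of points (possibly of different lengths) from a set equipped with a nonnegative distance function $f$. A traversal of $x$ and $y$ uses two markers, initially placed at the first points of $x$ and of $y$. At every step one marker or both markers simultaneously move one point forward in their sequences; at the end both markers must be at the last points of their sequences. The cost of a traversal is the maximum of $f(s,t)$ over all configurations occurring in the traversal (the initial one included), where $s$ and $t$ are the points the two markers point at. $\mathrm{Frechet}(x,y)$ is the minimum cost of a traversal. -}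

module Defs where

open import Data.Fin using (Fin; zero; suc; toℕ)
open import Data.List using (List; []; _∷_; _++_; [_]; concatMap; replicate; reverse)
open import Data.List using () renaming (map to mapᴸ)
open import Data.Maybe using (Maybe; just; nothing) renaming (map to mapᴹ)
open import Data.Nat using (ℕ; zero; suc; _+_; _*_)
open import Data.Product using (∃; _×_; _,_)
open import Data.Rational using (ℚ; _⊔_) renaming (_≤_ to _≤ℚ_; _+_ to _+ℚ_; 0ℚ to 0q)
open import Data.Vec using (Vec; []; _∷_; lookup; sum; zipWith; map; toList)
open import Data.Vec using () renaming (replicate to replicateⱽ)
open import Function.Bundles using (_↔_)
open import Relation.Binary.PropositionalEquality using (_≡_)

Finite : Set → Set
Finite A = ∃ λ n → A ↔ Fin n

BitVector : ℕ → Set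
BitVector d = Vec (Fin 2) d

Orthogonal : ∀ {d} → BitVector d → BitVector d → Set
Orthogonal α β = sum (zipWith (λ a b → toℕ a * toℕ b) α β) ≡ 0

HasOrthogonalPair : ∀ {n d} → Vec (BitVector d) n → Vec (BitVector d) n → Set
HasOrthogonalPair {n} α β =
  ∃ λ (i : Fin n) → ∃ λ (j : Fin n) → Orthogonal (lookup α i) (lookup β j)

module _ {A : Set} where

  NonNegative : (A → A → ℚ) → Set
  NonNegative f = ∀ s t → 0q ≤ℚ f s t

  TriangleInequality : (A → A → ℚ) → Set
  TriangleInequality f = ∀ s t u → f s u ≤ℚ f s t +ℚ f t u

  -- The indices are the parts of the two sequences that remain to be visited,
  -- the markers standing on the first elements.  In particular an empty
  -- sequence has no traversal.
  data Traversal : List A → List A → Set where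
    end    : ∀ {s t} → Traversal [ s ] [ t ]
    first  : ∀ {s s′ t x y} → Traversal (s′ ∷ x) (t ∷ y) →
             Traversal (s ∷ s′ ∷ x) (t ∷ y)
    second : ∀ {s t t′ x y} → Traversal (s ∷ x) (t′ ∷ y) →
             Traversal (s ∷ x) (t ∷ t′ ∷ y)
    both   : ∀ {s s′ t t′ x y} → Traversal (s′ ∷ x) (t′ ∷ y) →
             Traversal (s ∷ s′ ∷ x) (t ∷ t′ ∷ y)

  cost : (A → A → ℚ) → ∀ {x y} → Traversal x y → ℚ
  cost f (end {s} {t})        = f s t
  cost f (first {s} {_} {t} τ)  = f s t ⊔ cost f τ
  cost f (second {s} {t} τ)     = f s t ⊔ cost f τ
  cost f (both {s} {_} {t} τ)   = f s t ⊔ cost f τ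

  -- Frechet(x, y) = v: the minimum cost of a traversal of x and y is v.
  IsFrechet : (A → A → ℚ) → List A → List A → ℚ → Set
  IsFrechet f x y v =
    (∃ λ (τ : Traversal x y) → cost f τ ≡ v) ×
    (∀ (τ : Traversal x y) → v ≤ℚ cost f τ)

-- Running time is the number of steps of a deterministic multitape Turing
-- machine.  The tape alphabet contains the input bits, a separator, the
-- points (so that a sequence of points is a word) and auxiliary symbols.

data Symbol (Point Aux : Set) : Set where
  blank : Symbol Point Aux
  bit   : Fin 2 → Symbol Point Aux
  sep   : Symbol Point Aux
  point : Point → Symbol Point Aux
  aux   : Aux → Symbol Point Aux

data Move : Set where
  left stay right : Move

-- A tape infinite to the right: the cells before the head, nearest first, and
-- the cells from the head on; all cells not listed are blank.
record Tape (Γ : Set) : Set where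
  constructor tape
  field
    before : List Γ
    after  : List Γ

open Tape public

module _ {Point Aux : Set} where
  private
    Γ = Symbol Point Aux

  read : Tape Γ → Γ
  read (tape _ [])      = blank
  read (tape _ (a ∷ _)) = a

  write : Γ → Tape Γ → Tape Γ
  write a (tape ls [])       = tape ls [ a ]
  write a (tape ls (_ ∷ rs)) = tape ls (a ∷ rs)

  -- A left move on the first cell leaves the head where it is.
  move : Move → Tape Γ → Tape Γ
  move stay  T                  = T
  move left  (tape [] rs)       = tape [] rs
  move left  (tape (l ∷ ls) rs) = tape ls (l ∷ rs)
  move right (tape ls [])       = tape (blank ∷ ls) []
  move right (tape ls (r ∷ rs)) = tape (r ∷ ls) rs

  act : Γ × Move → Tape Γ → Tape Γ
  act (a , m) T = move m (write a T)

  contents : Tape Γ → List Γ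
  contents (tape ls rs) = reverse ls ++ rs

  inputTape : List Γ → Tape Γ
  inputTape w = tape [] w

  Holds : Tape Γ → List Γ → Set
  Holds T w = ∃ λ k → contents T ≡ w ++ replicate k blank

  encode : ∀ {n d} → Vec (BitVector d) n → List Γ
  encode α = concatMap (λ v → toList (map bit v) ++ [ sep ]) (toList α)

-- Tapes 0 and 1 carry the two input lists, tapes 2 and 3 the two output
-- sequences; there are `work` further tapes.  The machine halts when the
-- transition is undefined.
record Machine (Point : Set) : Set₁ where
  field
    Aux         : Set
    auxFinite   : Finite Aux
    State       : Set
    stateFinite : Finite State
    work        : ℕ
    start       : State
    δ           : State → Vec (Symbol Point Aux) (4 + work) →
                  Maybe (State × Vec (Symbol Point Aux × Move) (4 + work))

  Config : Set
  Config = State × Vec (Tape (Symbol Point Aux)) (4 + work)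

  next : Config → Maybe Config
  next (q , Ts) =
    mapᴹ (λ (q′ , as) → q′ , zipWith act as Ts) (δ q (map read Ts))

  data HaltsIn : ℕ → Config → Config → Set where
    halt : ∀ {C} → next C ≡ nothing → HaltsIn 0 C C
    step : ∀ {t C C′ D} → next C ≡ just C′ → HaltsIn t C′ D → HaltsIn (suc t) C D

  initial : ∀ {n d} → Vec (BitVector d) n → Vec (BitVector d) n → Config
  initial α β =
    start , inputTape (encode α) ∷ inputTape (encode β) ∷ replicateⱽ (2 + work) (inputTape [])

  OutputsIn : ∀ {n d} → ℕ → Vec (BitVector d) n → Vec (BitVector d) n →
              List Point → List Point → Set
  OutputsIn t α β P₁ P₂ =
    ∃ λ q → ∃ λ Ts → HaltsIn t (initial α β) (q , Ts) ×
      Holds (lookup Ts (suc (suc zero))) (mapᴸ point P₁) ×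
      Holds (lookup Ts (suc (suc (suc zero)))) (mapᴸ point P₂)

{-# OPTIONS --safe #-}

-- Distances are 0 (near) or 1 (far), so the distance is 0 exactly when some
-- traversal visits near pairs only.  The sequences are
--   P₁ = s₁ s₁ (r₁ α t₁ s₁) … (r₁ α′ t₁ s₁) z₁ z₁
--   P₂ = w₂ v₂ (n₂ β m₂ m₂) … (n₂ β′ m₂ m₂) f₂ w₂
-- with one parenthesis for each vector.  While the second marker waits at w₂
-- the first one moves freely; as v₂ is near s₁ only, it must then be just before
-- some block r₁ α, where it waits until the second marker reaches some block n₂ β.
-- As f₂ is near t₁ only, the first marker must cross α before the second one
-- leaves the blocks.  It enters α from r₁, which is near no point of the blocks
-- except n₂, and the entries carry alternating parities that force both markers
-- to move together through α and β; so all products α[h] β[h] vanish.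
--
-- Both lists have the same shape, so a machine can read them in lockstep and
-- write one point of each sequence at every step.

module Submission where

open import Defs
open import Data.Bool using (Bool; true; false; T; _∧_; if_then_else_)
open import Data.Bool.Properties using (T-∧)
open import Data.Fin using (Fin; zero; suc; toℕ; opposite; _≟_)
open import Data.Fin.Properties using (+↔⊎; *↔×)
open import Data.List using (List; []; _∷_; [_]; _++_; _ʳ++_) renaming (map to mapᴸ)
open import Data.List.Properties using (reverse-involutive)
open import Data.Maybe using (Maybe; just; nothing)
open import Data.Nat using (ℕ; zero; suc; _+_; _*_; _≤_; _≡ᵇ_; >-nonZero)
open import Data.Nat.Properties
  using (≡ᵇ⇒≡; ≡⇒≡ᵇ; m+n≡0⇒m≡0; m+n≡0⇒n≡0; m≤m*n; +-mono-≤; +-monoʳ-≤; *-mono-≤; *-monoʳ-≤; *-distribʳ-+; module ≤-Reasoning)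
open import Data.Nat.Tactic.RingSolver using (solve-∀)
open import Data.Product using (Σ; ∃; _×_; _,_; proj₁; proj₂)
open import Data.Product.Function.NonDependent.Propositional using (_×-↔_)
open import Data.Rational using (ℚ; 0ℚ; 1ℚ; _⊔_) renaming (_≤_ to _≤ℚ_)
open import Data.Rational.Properties using (_≤?_) renaming (≤-refl to ≤ℚ-refl; ≤-reflexive to ≤ℚ-reflexive)
open import Data.Sum using (_⊎_; inj₁; inj₂)
open import Data.Sum.Function.Propositional using (_⊎-↔_)
open import Data.Unit using (⊤; tt)
open import Data.Vec using (Vec; []; _∷_; lookup; map; toList)
open import Function using (_∘_)
open import Function.Bundles using (Equivalence)
open import Function.Properties.Inverse using (↔-refl; ↔-sym; ↔-trans)
open import Relation.Binary.PropositionalEquality using (_≡_; refl; sym; cong; subst; module ≡-Reasoning)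
open import Relation.Nullary using (¬_; contradiction)
open import Relation.Nullary.Decidable using (⌊_⌋; toWitness; toWitnessFalse)

-- Finite types

Fin-finite : ∀ n → Finite (Fin n)
Fin-finite n = n , ↔-refl

⊎-finite : ∀ {A B} → Finite A → Finite B → Finite (A ⊎ B)
⊎-finite (m , A↔) (n , B↔) = m + n , ↔-trans (A↔ ⊎-↔ B↔) (↔-sym +↔⊎)

×-finite : ∀ {A B} → Finite A → Finite B → Finite (A × B)
×-finite (m , A↔) (n , B↔) = m * n , ↔-trans (A↔ ×-↔ B↔) (↔-sym *↔×)

-- Traversals under distances 0 and 1

module Bipartite {A B : Set} (near : A → B → Bool) where

  gap : A → B → ℚ
  gap s t = if near s t then 0ℚ else 1ℚ

  -- With distance 0 inside a side, the triangle inequality fails once a point is near one point of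
  -- the other side and far from another.
  distance : A ⊎ B → A ⊎ B → ℚ
  distance (inj₁ s) (inj₂ t) = gap s t
  distance (inj₂ t) (inj₁ s) = gap s t
  distance (inj₁ _) (inj₁ _) = 0ℚ
  distance (inj₂ _) (inj₂ _) = 0ℚ

  0≤1 : 0ℚ ≤ℚ 1ℚ
  0≤1 = toWitness {a? = 0ℚ ≤? 1ℚ} tt

  gap-nonNegative : ∀ s t → 0ℚ ≤ℚ gap s t
  gap-nonNegative s t with near s t
  ... | true  = ≤ℚ-refl
  ... | false = 0≤1

  distance-nonNegative : NonNegative distance
  distance-nonNegative (inj₁ s) (inj₂ t) = gap-nonNegative s t
  distance-nonNegative (inj₂ t) (inj₁ s) = gap-nonNegative s t
  distance-nonNegative (inj₁ _) (inj₁ _) = ≤ℚ-refl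
  distance-nonNegative (inj₂ _) (inj₂ _) = ≤ℚ-refl

  -- Remainders need not be written as a cons, so they may be stuck terms such as `entries₁ p α x`;
  -- they are nonempty anyway, as no constructor has an empty index.
  data Free : List A → List B → Set where
    end    : ∀ {s t} → T (near s t) → Free [ s ] [ t ]
    first  : ∀ {s t x y} → T (near s t) → Free x (t ∷ y) → Free (s ∷ x) (t ∷ y)
    second : ∀ {s t x y} → T (near s t) → Free (s ∷ x) y → Free (s ∷ x) (t ∷ y)
    both   : ∀ {s t x y} → T (near s t) → Free x y → Free (s ∷ x) (t ∷ y)

  headNear : ∀ {s t x y} → Free (s ∷ x) (t ∷ y) → T (near s t)
  headNear (end p)      = p
  headNear (first p _)  = p
  headNear (second p _) = p
  headNear (both p _)   = p

  gap-near : ∀ {s t} → T (near s t) → gap s t ≡ 0ℚ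
  gap-near {s} {t} p with near s t
  ... | true = refl

  gap-⊔-zero : ∀ {s t c} → T (near s t) → c ≡ 0ℚ → gap s t ⊔ c ≡ 0ℚ
  gap-⊔-zero {s} {t} p refl with near s t
  ... | true = refl

  Walk : List A → List B → Set
  Walk x y = Traversal (mapᴸ inj₁ x) (mapᴸ inj₂ y)

  free⇒zeroCost : ∀ {x y} → Free x y → ∃ λ (τ : Walk x y) → cost distance τ ≡ 0ℚ
  free⇒zeroCost (end p) = end , gap-near p
  free⇒zeroCost (first {x = _ ∷ _} p φ) with free⇒zeroCost φ
  ... | τ , e = first τ , gap-⊔-zero p e
  free⇒zeroCost (second {y = _ ∷ _} p φ) with free⇒zeroCost φ
  ... | τ , e = second τ , gap-⊔-zero p e
  free⇒zeroCost (both {x = _ ∷ _} {y = _ ∷ _} p φ) with free⇒zeroCost φ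
  ... | τ , e = both τ , gap-⊔-zero p e

  FreeOr1 : List A → List B → ℚ → Set
  FreeOr1 x y c = (Free x y × c ≡ 0ℚ) ⊎ c ≡ 1ℚ

  -- A far pair makes the maximum 1 whatever follows, and a near one leaves it unchanged; `move`
  -- stands for any of the three moves.
  extend : ∀ {s t x y x′ y′ c} → (T (near s t) → Free x y → Free x′ y′) →
           FreeOr1 x y c → FreeOr1 x′ y′ (gap s t ⊔ c)
  extend {s} {t} move F with near s t
  extend move (inj₁ (φ , refl)) | true  = inj₁ (move tt φ , refl)
  extend move (inj₂ refl)       | true  = inj₂ refl
  extend move (inj₁ (_ , refl)) | false = inj₂ refl
  extend move (inj₂ refl)       | false = inj₂ refl

  classify : ∀ x y (τ : Walk x y) → FreeOr1 x y (cost distance τ)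
  classify (s ∷ [])     (t ∷ []) end with near s t in eq
  ... | true  = inj₁ (end (subst T (sym eq) tt) , refl)
  ... | false = inj₂ refl
  classify (s ∷ s′ ∷ x) (t ∷ [])     (first τ)  = extend first (classify (s′ ∷ x) (t ∷ []) τ)
  classify (s ∷ [])     (t ∷ t′ ∷ y) (second τ) = extend second (classify (s ∷ []) (t′ ∷ y) τ)
  classify (s ∷ s′ ∷ x) (t ∷ t′ ∷ y) (first τ)  = extend first (classify (s′ ∷ x) (t ∷ t′ ∷ y) τ)
  classify (s ∷ s′ ∷ x) (t ∷ t′ ∷ y) (second τ) = extend second (classify (s ∷ s′ ∷ x) (t′ ∷ y) τ)
  classify (s ∷ s′ ∷ x) (t ∷ t′ ∷ y) (both τ)   = extend both (classify (s′ ∷ x) (t′ ∷ y) τ)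

  someWalk : ∀ s x t y → Walk (s ∷ x) (t ∷ y)
  someWalk s []       t []       = end
  someWalk s (s′ ∷ x) t y        = first (someWalk s′ x t y)
  someWalk s []       t (t′ ∷ y) = second (someWalk s [] t′ y)

  free⇒frechet0 : ∀ {x y} → Free x y → IsFrechet distance (mapᴸ inj₁ x) (mapᴸ inj₂ y) 0ℚ
  free⇒frechet0 {x} {y} φ = free⇒zeroCost φ , bound
    where
    bound : ∀ τ → 0ℚ ≤ℚ cost distance τ
    bound τ with classify x y τ
    ... | inj₁ (_ , e) = ≤ℚ-reflexive (sym e)
    ... | inj₂ e       = subst (0ℚ ≤ℚ_) (sym e) 0≤1

  -- Every walk then costs 1, so any walk attains the minimum; the sequences are nonempty so that
  -- there is one.
  ¬free⇒frechet1 : ∀ {s x t y} → ¬ Free (s ∷ x) (t ∷ y) →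
    IsFrechet distance (mapᴸ inj₁ (s ∷ x)) (mapᴸ inj₂ (t ∷ y)) 1ℚ
  ¬free⇒frechet1 {s} {x} {t} {y} ¬φ =
    (someWalk s x t y , one (someWalk s x t y)) , λ τ → ≤ℚ-reflexive (sym (one τ))
    where
    one : ∀ (τ : Walk (s ∷ x) (t ∷ y)) → cost distance τ ≡ 1ℚ
    one τ with classify (s ∷ x) (t ∷ y) τ
    ... | inj₁ (φ , _) = contradiction φ ¬φ
    ... | inj₂ e       = e

-- The points and the two sequences

Point₁ Point₂ : Set
Point₁ = (Fin 2 × Fin 2) ⊎ (Fin 2 ⊎ Fin 2)
Point₂ = (Fin 2 × Fin 2) ⊎ Fin 5

pattern entry p a = inj₁ (p , a)
-- `s₁` and `t₁` share a constructor because at both the first marker can wait while the second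
-- crosses a block.
pattern anchor k  = inj₂ (inj₁ k)
pattern s₁        = anchor zero
pattern t₁        = anchor (suc zero)
pattern r₁        = inj₂ (inj₂ zero)
pattern z₁        = inj₂ (inj₂ (suc zero))
pattern w₂        = inj₂ zero
pattern v₂        = inj₂ (suc zero)
pattern n₂        = inj₂ (suc (suc zero))
pattern m₂        = inj₂ (suc (suc (suc zero)))
pattern f₂        = inj₂ (suc (suc (suc (suc zero))))

near : Point₁ → Point₂ → Bool
near _           w₂          = true
near (entry p a) (entry q b) = ⌊ p ≟ q ⌋ ∧ (toℕ a * toℕ b ≡ᵇ 0)
near (anchor _)  (entry _ _) = true
near (anchor _)  n₂          = true
near (anchor _)  m₂          = true
near s₁          v₂          = true
near t₁          f₂          = true
near r₁          n₂          = true
near _           _           = false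

open Bipartite near

Point : Set
Point = Point₁ ⊎ Point₂

point-finite : Finite Point
point-finite = ⊎-finite
  (⊎-finite (×-finite (Fin-finite 2) (Fin-finite 2)) (⊎-finite (Fin-finite 2) (Fin-finite 2)))
  (⊎-finite (×-finite (Fin-finite 2) (Fin-finite 2)) (Fin-finite 5))

¬triangle : ¬ TriangleInequality distance
¬triangle Δ = toWitnessFalse {a? = 1ℚ ≤? 0ℚ} tt (Δ (inj₁ z₁) (inj₂ w₂) (inj₂ v₂))

entries₁ : ∀ {d} → Fin 2 → BitVector d → List Point₁ → List Point₁
entries₁ p []      x = x
entries₁ p (a ∷ α) x = entry p a ∷ entries₁ (opposite p) α x

entries₂ : ∀ {d} → Fin 2 → BitVector d → List Point₂ → List Point₂
entries₂ p []      y = y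
entries₂ p (b ∷ β) y = entry p b ∷ entries₂ (opposite p) β y

-- `z₁` is near `w₂` only, so a first marker that runs to the end under the initial `w₂` is stuck.
-- Two copies keep the length equal to that of `blocks₂`.
blocks₁ : ∀ {d k} → Vec (BitVector d) k → List Point₁
blocks₁ []      = z₁ ∷ z₁ ∷ []
blocks₁ (a ∷ α) = r₁ ∷ entries₁ zero a (t₁ ∷ s₁ ∷ blocks₁ α)

blocks₂ : ∀ {d k} → Vec (BitVector d) k → List Point₂
blocks₂ []      = f₂ ∷ w₂ ∷ []
blocks₂ (b ∷ β) = n₂ ∷ entries₂ zero b (m₂ ∷ m₂ ∷ blocks₂ β)

sequence₁ : ∀ {d k} → Vec (BitVector d) k → List Point₁
sequence₁ α = s₁ ∷ s₁ ∷ blocks₁ α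

sequence₂ : ∀ {d k} → Vec (BitVector d) k → List Point₂
sequence₂ β = w₂ ∷ v₂ ∷ blocks₂ β

entry-near : ∀ p a q b → T (near (entry p a) (entry q b)) →
             p ≡ q × toℕ a * toℕ b ≡ 0
entry-near p a q b h with Equivalence.to T-∧ h
... | p≡q , ab≡0 = toWitness p≡q , ≡ᵇ⇒≡ _ 0 ab≡0

near-entry : ∀ p a b → toℕ a * toℕ b ≡ 0 → T (near (entry p a) (entry p b))
near-entry zero       a b e = ≡⇒≡ᵇ _ 0 e
near-entry (suc zero) a b e = ≡⇒≡ᵇ _ 0 e

opposite-≢ : ∀ (p : Fin 2) → ¬ opposite p ≡ p
opposite-≢ zero       ()
opposite-≢ (suc zero) ()

-- From an orthogonal pair to a free traversal

lastWait : ∀ a x → Free (a ∷ x) (w₂ ∷ [])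
lastWait a []       = end tt
lastWait a (a′ ∷ x) = first tt (lastWait a′ x)

passEntries₂ : ∀ {d k x y} p (β : BitVector d) →
               Free (anchor k ∷ x) y → Free (anchor k ∷ x) (entries₂ p β y)
passEntries₂ p []      φ = φ
passEntries₂ p (b ∷ β) φ = second tt (passEntries₂ (opposite p) β φ)

passBlock₂ : ∀ {d k x y} (β : BitVector d) → Free (anchor k ∷ x) y →
             Free (anchor k ∷ x) (n₂ ∷ entries₂ zero β (m₂ ∷ m₂ ∷ y))
passBlock₂ β φ = second tt (passEntries₂ zero β (second tt (second tt φ)))

finishBlocks₂ : ∀ {d k} x (β : Vec (BitVector d) k) → Free (t₁ ∷ x) (blocks₂ β)
finishBlocks₂ x []      = second tt (lastWait t₁ x)
finishBlocks₂ x (b ∷ β) = passBlock₂ b (finishBlocks₂ x β)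

matchEntries : ∀ {d x y} p (α β : BitVector d) → Orthogonal α β →
               Free x y → Free (entries₁ p α x) (entries₂ p β y)
matchEntries p []      []      _ φ = φ
matchEntries p (a ∷ α) (b ∷ β) e φ =
  both (near-entry p a b (m+n≡0⇒m≡0 _ e))
       (matchEntries (opposite p) α β (m+n≡0⇒n≡0 (toℕ a * toℕ b) e) φ)

matchBlock : ∀ {d k} x (α : BitVector d) (β : Vec (BitVector d) k) j → Orthogonal α (lookup β j) →
             Free (s₁ ∷ r₁ ∷ entries₁ zero α (t₁ ∷ x)) (blocks₂ β)
matchBlock x α (b ∷ β) zero    e =
  -- The markers meet at `r₁` and `n₂` and cross the entries together up to `t₁` and `m₂`; then the
  -- first waits at `t₁` while the second passes the rest.
  first tt (both tt (matchEntries zero α b e (second tt (second tt (finishBlocks₂ x β)))))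
matchBlock x α (b ∷ β) (suc j) e = passBlock₂ b (matchBlock x α β j e)

passEntries₁ : ∀ {d x y} p (α : BitVector d) → Free x (w₂ ∷ y) → Free (entries₁ p α x) (w₂ ∷ y)
passEntries₁ p []      φ = φ
passEntries₁ p (a ∷ α) φ = first tt (passEntries₁ (opposite p) α φ)

-- Under the initial `w₂` the first marker skips the blocks before block `i` and stops at the `s₁`
-- in front of it.
selectBlock : ∀ {d k l} (α : Vec (BitVector d) k) (β : Vec (BitVector d) l) i j →
              Orthogonal (lookup α i) (lookup β j) → Free (s₁ ∷ blocks₁ α) (sequence₂ β)
selectBlock (a ∷ α) β zero    j e = second tt (second tt (matchBlock _ a β j e))
selectBlock (a ∷ α) β (suc i) j e =
  first tt (first tt (passEntries₁ zero a (first tt (selectBlock α β i j e))))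

orthogonal⇒free : ∀ {d k l} (α : Vec (BitVector d) k) (β : Vec (BitVector d) l) i j →
  Orthogonal (lookup α i) (lookup β j) → Free (sequence₁ α) (sequence₂ β)
orthogonal⇒free α β i j e = first tt (selectBlock α β i j e)

-- From a free traversal to an orthogonal pair

-- A move of one marker alone would pair entries of opposite parity, which are far. So the markers
-- move together, and each pair `a`, `b` they meet has product 0.
free⇒orthogonal : ∀ {d x y} p (α β : BitVector d) →
                  Free (entries₁ p α x) (entries₂ p β y) → Orthogonal α β
free⇒orthogonal p []      []      φ = refl
free⇒orthogonal p (a ∷ α) (b ∷ β) φ
  rewrite proj₂ (entry-near p a p b (headNear φ)) = rest α β φ
  where
  rest : ∀ {d x y} (α β : BitVector d) →
         Free (entry p a ∷ entries₁ (opposite p) α x) (entry p b ∷ entries₂ (opposite p) β y) →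
         Orthogonal α β
  rest []       []       _            = refl
  rest (a′ ∷ _) (_ ∷ _)  (first _ φ)  =
    contradiction (proj₁ (entry-near (opposite p) a′ p b (headNear φ))) (opposite-≢ p)
  rest (_ ∷ _)  (b′ ∷ _) (second _ φ) =
    contradiction (sym (proj₁ (entry-near p a (opposite p) b′ (headNear φ)))) (opposite-≢ p)
  rest α@(_ ∷ _) β@(_ ∷ _) (both _ φ) = free⇒orthogonal (opposite p) α β φ

-- `r₁` is far from the entries of `β` and `n₂` from those of `α`, so only a joint move leads on. If
-- `d` is 0, the vectors are orthogonal by computation.
free⇒orthogonalBlock : ∀ {d x y} (α β : BitVector d) →
  Free (r₁ ∷ entries₁ zero α (t₁ ∷ x)) (n₂ ∷ entries₂ zero β (m₂ ∷ y)) → Orthogonal α β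
free⇒orthogonalBlock []      []      _            = refl
free⇒orthogonalBlock (_ ∷ _) (_ ∷ _) (first _ φ)  with () ← headNear φ
free⇒orthogonalBlock (_ ∷ _) (_ ∷ _) (second _ φ) with () ← headNear φ
free⇒orthogonalBlock α@(_ ∷ _) β@(_ ∷ _) (both _ φ) = free⇒orthogonal zero α β φ

-- A nonempty suffix of a word of blocks over Q followed by f₂; nothing is
-- required after f₂, which only t₁ is near.
data Region {d} (Q : BitVector d → Set) : List Point₂ → Set where
  atF     : ∀ {y} → Region Q (f₂ ∷ y)
  atM     : ∀ {y} → Region Q y → Region Q (m₂ ∷ y)
  atEntry : ∀ {p b y} → Region Q y → Region Q (entry p b ∷ y)
  atN     : ∀ {β y y′} → Q β → y ≡ entries₂ zero β (m₂ ∷ y′) → Region Q y → Region Q (n₂ ∷ y)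

entries₂-region : ∀ {d e Q y} p (β : BitVector e) → Region {d} Q y → Region Q (entries₂ p β y)
entries₂-region p []      ρ = ρ
entries₂-region p (b ∷ β) ρ = atEntry (entries₂-region (opposite p) β ρ)

blocks₂-region : ∀ {d k Q} (β : Vec (BitVector d) k) → (∀ j → Q (lookup β j)) → Region Q (blocks₂ β)
blocks₂-region []      q = atF
blocks₂-region (b ∷ β) q =
  atN (q zero) refl (entries₂-region zero b (atM (atM (blocks₂-region β (q ∘ suc)))))

module _ {d} {Q : BitVector d → Set} {R : Set} where

  -- `R` is kept abstract: on passing to the tail of `α`, `h ∘ suc` shifts the index while the goal
  -- stays about the whole input.
  OrthogonalSuffices : ∀ {k} → Vec (BitVector d) k → Set
  OrthogonalSuffices α = ∀ i β → Q β → Orthogonal (lookup α i) β → R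

  -- In a region `z₁` is near nothing and `r₁` is near `n₂` only, where a block begins on both
  -- sides.
  blocks₁-inRegion : ∀ {k y} (α : Vec (BitVector d) k) → OrthogonalSuffices α →
                     Region Q y → Free (blocks₁ α) y → R
  blocks₁-inRegion []      h atF            φ with () ← headNear φ
  blocks₁-inRegion []      h (atM _)        φ with () ← headNear φ
  blocks₁-inRegion []      h (atEntry _)    φ with () ← headNear φ
  blocks₁-inRegion []      h (atN _ _ _)    φ with () ← headNear φ
  blocks₁-inRegion (a ∷ α) h atF            φ with () ← headNear φ
  blocks₁-inRegion (a ∷ α) h (atM _)        φ with () ← headNear φ
  blocks₁-inRegion (a ∷ α) h (atEntry _)    φ with () ← headNear φ
  blocks₁-inRegion (a ∷ α) h (atN q refl _) φ = h zero _ q (free⇒orthogonalBlock a _ φ)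

  -- `s₁` is far from `f₂`, so the first marker has to leave it while the second is still inside the
  -- region.
  inRegion : ∀ {x y} → (∀ {y} → Region Q y → Free x y → R) →
             Region Q y → Free (s₁ ∷ x) y → R
  inRegion h atF          φ with () ← headNear φ
  inRegion h (atM ())     (end _)
  inRegion h (atEntry ()) (end _)
  inRegion h (atN _ _ ()) (end _)
  inRegion h ρ            (first _ φ)  = h ρ φ
  inRegion h (atM ρ)      (second _ φ) = inRegion h ρ φ
  inRegion h (atEntry ρ)  (second _ φ) = inRegion h ρ φ
  inRegion h (atN _ _ ρ)  (second _ φ) = inRegion h ρ φ
  inRegion h (atM ρ)      (both _ φ)   = h ρ φ
  inRegion h (atEntry ρ)  (both _ φ)   = h ρ φ
  inRegion h (atN _ _ ρ)  (both _ φ)   = h ρ φ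

  -- The cons rules out a traversal that ends at `v₂`.
  module _ {b y} (ρ : Region Q (b ∷ y)) where

    -- When the second marker reaches `v₂`, the first may be at any nonempty suffix; one component
    -- handles each.
    Tails : List Point₁ → Set
    Tails []      = ⊤
    Tails (a ∷ x) = (Free (a ∷ x) (v₂ ∷ b ∷ y) → R) × Tails x

    fromW : ∀ {x} → Tails x → Free x (w₂ ∷ v₂ ∷ b ∷ y) → R
    fromW (_ , h) (first _ φ)  = fromW h φ
    fromW (h , _) (second _ φ) = h φ
    fromW {_ ∷ _ ∷ _} (_ , h , _) (both _ φ) = h φ

    -- `h` takes over when the first marker leaves `s₁` with the second in the region, `h′` when it
    -- leaves with the second still at `v₂`.
    fromV : ∀ {x} → (∀ {y} → Region Q y → Free x y → R) → (Free x (v₂ ∷ b ∷ y) → R) →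
            Free (s₁ ∷ x) (v₂ ∷ b ∷ y) → R
    fromV h h′ (first _ φ)  = h′ φ
    fromV h h′ (second _ φ) = inRegion h ρ φ
    fromV h h′ (both _ φ)   = h ρ φ

    entries₁-tails : ∀ {e x} p (α : BitVector e) → Tails x → Tails (entries₁ p α x)
    entries₁-tails p []      h = h
    entries₁-tails p (a ∷ α) h = (λ φ → contradiction (headNear φ) λ ()) , entries₁-tails (opposite p) α h

    blocks₁-fromV : ∀ {k} (α : Vec (BitVector d) k) → Free (blocks₁ α) (v₂ ∷ b ∷ y) → R
    blocks₁-fromV []      φ with () ← headNear φ
    blocks₁-fromV (_ ∷ _) φ with () ← headNear φ

    sBlocks₁-fromV : ∀ {k} (α : Vec (BitVector d) k) → OrthogonalSuffices α →
                     Free (s₁ ∷ blocks₁ α) (v₂ ∷ b ∷ y) → R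
    sBlocks₁-fromV α h = fromV (blocks₁-inRegion α h) (blocks₁-fromV α)

    blocks₁-tails : ∀ {k} (α : Vec (BitVector d) k) → OrthogonalSuffices α → Tails (blocks₁ α)
    blocks₁-tails []      h = blocks₁-fromV {0} [] , (λ φ → contradiction (headNear φ) λ ()) , tt
    blocks₁-tails (a ∷ α) h =
      blocks₁-fromV (a ∷ α) ,
      entries₁-tails zero a
        ((λ φ → contradiction (headNear φ) λ ()) ,
         sBlocks₁-fromV α (h ∘ suc) ,
         blocks₁-tails α (h ∘ suc))

    sequence₁-tails : ∀ {k} (α : Vec (BitVector d) k) → OrthogonalSuffices α → Tails (sequence₁ α)
    sequence₁-tails α h =
      -- The next point is `s₁` again, so leaving the first `s₁` inside the region leads to another
      -- wait.
      fromV (inRegion (blocks₁-inRegion α h)) (sBlocks₁-fromV α h) ,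
      sBlocks₁-fromV α h ,
      blocks₁-tails α h

free⇒hasOrthogonalPair : ∀ {k d} (α β : Vec (BitVector d) k) →
  Free (sequence₁ α) (sequence₂ β) → HasOrthogonalPair α β
free⇒hasOrthogonalPair {k} {d} α β φ = go (blocks₂ β) (blocks₂-region β λ j → j , refl) φ
  where
  -- `blocks₂ β` does not reduce to a cons; generalised to `y`, it is seen to be one from its
  -- region.
  go : ∀ y → Region (λ b → ∃ λ j → lookup β j ≡ b) y → Free (sequence₁ α) (w₂ ∷ v₂ ∷ y) → HasOrthogonalPair α β
  go (_ ∷ _) ρ = fromW ρ (sequence₁-tails ρ α λ { i _ (j , refl) e → i , j , e })

-- The machine

State : Set
State = Fin 2 ⊎ Fin 6

pattern entries p = inj₁ p
pattern opening₁  = inj₂ zero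
pattern opening₂  = inj₂ (suc zero)
pattern block     = inj₂ (suc (suc zero))
pattern blockEnd  = inj₂ (suc (suc (suc zero)))
pattern closing   = inj₂ (suc (suc (suc (suc zero))))
pattern halted    = inj₂ (suc (suc (suc (suc (suc zero)))))

Γ : Set
Γ = Symbol Point (Fin 0)

emit : State → Move → Vec Γ 4 → Point₁ → Point₂ → Maybe (State × Vec (Γ × Move) 4)
emit q μ (a ∷ b ∷ _) x y =
  just (q , (a , μ) ∷ (b , μ) ∷ (point (inj₁ x) , right) ∷ (point (inj₂ y) , right) ∷ [])

transition : State → Vec Γ 4 → Maybe (State × Vec (Γ × Move) 4)
transition opening₁    σ                     = emit opening₂ stay σ s₁ w₂
transition opening₂    σ                     = emit block stay σ s₁ v₂
-- Every encoded vector ends with `sep`, also when `d` is 0, so a blank means that no vector is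
-- left.
transition block       σ@(blank ∷ _)         = emit closing stay σ z₁ f₂
transition block       σ                     = emit (entries zero) stay σ r₁ n₂
transition (entries p) σ@(bit a ∷ bit b ∷ _) = emit (entries (opposite p)) right σ (entry p a) (entry p b)
transition (entries p) σ@(sep ∷ _)           = emit blockEnd stay σ t₁ m₂
transition (entries p) _                     = nothing
transition blockEnd    σ                     = emit block right σ s₁ m₂
transition closing     σ                     = emit halted stay σ z₁ w₂
transition halted      _                     = nothing

machine : Machine Point
machine = record
  { Aux = Fin 0 ; auxFinite = Fin-finite 0
  ; State = State ; stateFinite = ⊎-finite (Fin-finite 2) (Fin-finite 6)
  ; work = 0 ; start = opening₁ ; δ = transition }

open Machine machine using (HaltsIn; halt; step; OutputsIn; initial)

word₁ : List Point₁ → List Γ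
word₁ = mapᴸ point ∘ mapᴸ inj₁

word₂ : List Point₂ → List Γ
word₂ = mapᴸ point ∘ mapᴸ inj₂

-- An output word lies reversed before its head; with `ʳ++` in `o₁` and `o₂`, writing one more point
-- is a definitional step.
Produces : ℕ → State × Vec (Tape Γ) 4 → List Γ → List Γ → Set
Produces k C o₁ o₂ = ∃ λ T₁ → ∃ λ T₂ →
  HaltsIn k C (halted , T₁ ∷ T₂ ∷ tape o₁ [] ∷ tape o₂ [] ∷ [])

infixr 5 _▷_

_▷_ : ∀ {k C C′ o₁ o₂} → Machine.next machine C ≡ just C′ → Produces k C′ o₁ o₂ → Produces (suc k) C o₁ o₂
e ▷ (T₁ , T₂ , h) = T₁ , T₂ , step e h

-- The continuation is quantified over parity and tapes because these may have changed when the
-- separators are reached.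
entries-run : ∀ {d k i₁ i₂ u₁ u₂ o₁ o₂} x y p (α β : BitVector d) →
  (∀ {p i₁ i₂ o₁ o₂} →
   Produces k (entries p , tape i₁ (sep ∷ u₁) ∷ tape i₂ (sep ∷ u₂) ∷ tape o₁ [] ∷ tape o₂ [] ∷ [])
     (word₁ x ʳ++ o₁) (word₂ y ʳ++ o₂)) →
  Produces (d + k)
    (entries p , tape i₁ ((toList (map bit α) ++ [ sep ]) ++ u₁) ∷ tape i₂ ((toList (map bit β) ++ [ sep ]) ++ u₂)
               ∷ tape o₁ [] ∷ tape o₂ [] ∷ [])
    (word₁ (entries₁ p α x) ʳ++ o₁) (word₂ (entries₂ p β y) ʳ++ o₂)
entries-run x y p []      []      h = h
entries-run x y p (a ∷ α) (b ∷ β) h = refl ▷ entries-run x y (opposite p) α β h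

-- The summands follow the steps of a block in order (one for `r₁`, `d` for the entries, two for the
-- end), so runs compose without arithmetic.
blocksTime : ℕ → ℕ → ℕ
blocksTime d zero    = 2
blocksTime d (suc k) = suc (d + (2 + blocksTime d k))

blocks-run : ∀ {d k i₁ i₂ o₁ o₂} (α β : Vec (BitVector d) k) →
  Produces (blocksTime d k)
    (block , tape i₁ (encode α) ∷ tape i₂ (encode β) ∷ tape o₁ [] ∷ tape o₂ [] ∷ [])
    (word₁ (blocks₁ α) ʳ++ o₁) (word₂ (blocks₂ β) ʳ++ o₂)
blocks-run []             []             = refl ▷ refl ▷ (_ , _ , halt refl)
-- The vectors are split because the step out of `block` computes only once the first symbol is
-- known.
blocks-run ([] ∷ α)       ([] ∷ β)       = refl ▷ refl ▷ refl ▷ blocks-run α β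
blocks-run ((a ∷ a′) ∷ α) ((b ∷ b′) ∷ β) =
  refl ▷ entries-run (t₁ ∷ s₁ ∷ blocks₁ α) (m₂ ∷ m₂ ∷ blocks₂ β) zero (a ∷ a′) (b ∷ b′)
           (refl ▷ refl ▷ blocks-run α β)

machine-run : ∀ {d k} (α β : Vec (BitVector d) k) →
  Produces (2 + blocksTime d k) (initial α β) (word₁ (sequence₁ α) ʳ++ []) (word₂ (sequence₂ β) ʳ++ [])
-- Writing back the blank turns the empty tape into `[ blank ]`, which is not `encode []`, so
-- `blocks-run` does not apply.
machine-run []              []              = refl ▷ refl ▷ refl ▷ refl ▷ (_ , _ , halt refl)
machine-run α@([] ∷ _)      β@([] ∷ _)      = refl ▷ refl ▷ blocks-run α β
machine-run α@((_ ∷ _) ∷ _) β@((_ ∷ _) ∷ _) = refl ▷ refl ▷ blocks-run α β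

holds-reverse : ∀ (u : List Γ) → Holds (tape (u ʳ++ []) []) u
holds-reverse u = 0 , cong (_++ []) (reverse-involutive u)

machine-outputs : ∀ {d k} (α β : Vec (BitVector d) k) →
  OutputsIn (2 + blocksTime d k) α β (mapᴸ inj₁ (sequence₁ α)) (mapᴸ inj₂ (sequence₂ β))
machine-outputs α β with machine-run α β
... | _ , _ , h = _ , _ , h , holds-reverse (word₁ (sequence₁ α)) , holds-reverse (word₂ (sequence₂ β))

-- Running time

time-closed : ∀ d k → 2 + blocksTime d k ≡ k * d + 3 * k + 4
time-closed d zero    = refl
time-closed d (suc k) = begin
  3 + d + (2 + blocksTime d k)   ≡⟨ cong (3 + d +_) (time-closed d k) ⟩
  3 + d + (k * d + 3 * k + 4)    ≡⟨ identity d k ⟩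
  suc k * d + 3 * suc k + 4      ∎
  where
  open ≡-Reasoning
  identity : ∀ d k → 3 + d + (k * d + 3 * k + 4) ≡ suc k * d + 3 * suc k + 4
  identity = solve-∀

time-bound : ∀ k d → 1 ≤ k → 1 ≤ d → 2 + blocksTime d k ≤ 8 * (k * d)
time-bound k d 1≤k 1≤d = begin
  2 + blocksTime d k                   ≡⟨ time-closed d k ⟩
  k * d + 3 * k + 4                    ≤⟨ +-mono-≤ (+-monoʳ-≤ (k * d) (*-monoʳ-≤ 3 k≤kd)) (*-monoʳ-≤ 4 1≤kd) ⟩
  -- `k * d + 3 * (k * d)` is `4 * (k * d)` by definition, which makes 8 in all.
  k * d + 3 * (k * d) + 4 * (k * d)    ≡⟨ *-distribʳ-+ (k * d) 4 4 ⟨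
  8 * (k * d)                          ∎
  where
  open ≤-Reasoning
  k≤kd : k ≤ k * d
  k≤kd = m≤m*n k d {{>-nonZero 1≤d}}
  1≤kd : 1 ≤ k * d
  1≤kd = *-mono-≤ 1≤k 1≤d

lemma10 : Σ Set λ Point → Finite Point ×
    Σ (Point → Point → ℚ) λ f → NonNegative f × ¬ TriangleInequality f ×
    Σ (Machine Point) λ M → Σ ℕ λ c →
    ∀ (n d : ℕ) (α β : Vec (BitVector d) n) →
    ∃ λ (P₁ : List Point) → ∃ λ (P₂ : List Point) → ∃ λ (t : ℕ) →
    Machine.OutputsIn M t α β P₁ P₂ ×
    (1 ≤ n → 1 ≤ d → t ≤ c * (n * d)) ×
    (HasOrthogonalPair α β → IsFrechet f P₁ P₂ 0ℚ) ×
    (¬ HasOrthogonalPair α β → IsFrechet f P₁ P₂ 1ℚ)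
lemma10 =
  Point , point-finite , distance , distance-nonNegative , ¬triangle , machine , 8 ,
  λ n d α β → _ , _ , _ ,
    machine-outputs α β ,
    time-bound n d ,
    (λ (i , j , e) → free⇒frechet0 (orthogonal⇒free α β i j e)) ,
    (λ ¬pair → ¬free⇒frechet1 (¬pair ∘ free⇒hasOrthogonalPair α β))
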